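{- For any $\varepsilon > 0$ there exist polynomials $x, y \in \mathbb{Z}[t]$ such that $x^3 \neq y^2$ and $\deg(x^3 - y^2)/\deg(x) < 1/2 + \varepsilon$. More precisely, for any even positive integer $\delta$ there exist polynomials $x, y \in \mathbb{Z}[t]$ such that $\deg(x) = 2\delta$, $\deg(y) = 3\delta$ and $\deg(x^3 - y^2) = \delta + 5$. -}

module Defs where

open import Data.Nat using (ℕ; zero; suc; _<_)
open import Data.Integer using (ℤ; _+_; _*_; -_; +_)
open import Data.List using (List; []; _∷_; map)
open import Data.Product using (_×_)
open import Relation.Binary.PropositionalEquality using (_≡_; _≢_)

-- Polynomials in ℤ[t], represented by coefficient lists, lowest degree first.
-- Trailing zeros are allowed; all notions below are insensitive to them.
Poly : Set
Poly = List ℤ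

coeff : Poly → ℕ → ℤ
coeff []       _       = + 0
coeff (a ∷ _)  zero    = a
coeff (_ ∷ p)  (suc k) = coeff p k

_⊕_ : Poly → Poly → Poly
[]      ⊕ q       = q
(a ∷ p) ⊕ []      = a ∷ p
(a ∷ p) ⊕ (b ∷ q) = (a + b) ∷ (p ⊕ q)

scale : ℤ → Poly → Poly
scale c p = map (c *_) p

_⊗_ : Poly → Poly → Poly
[]      ⊗ q = []
(a ∷ p) ⊗ q = scale a q ⊕ (+ 0 ∷ (p ⊗ q))

⊖_ : Poly → Poly
⊖ p = map -_ p

_⊝_ : Poly → Poly → Poly
p ⊝ q = p ⊕ (⊖ q)

cube : Poly → Poly
cube x = x ⊗ (x ⊗ x)

square : Poly → Poly
square y = y ⊗ y

IsZeroPoly : Poly → Set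
IsZeroPoly p = ∀ k → coeff p k ≡ + 0

HasDegree : Poly → ℕ → Set
HasDegree p d = (coeff p d ≢ + 0) × (∀ k → d < k → coeff p k ≡ + 0)

{-# OPTIONS --safe #-}

-- Danilov's identity: if d q² = p² + 1, then x = d (p² - 6 p + 4) and
-- y = d² q (p² - 9 p + 19) satisfy x³ - y² = 27 d³ (2 p - 11), where the right
-- hand side is only linear in p. For d = t² + 1 the Pell equation is solved by
-- the odd powers p + q √d of the unit t + √d of norm -1, and deg p = δ - 1
-- ranges over all odd numbers.
module Submission where

open import Defs
open import Data.Nat using (ℕ; _+_; _*_; _<_)
open import Data.Nat.Divisibility using (_∣_; divides)
open import Data.Integer using (+_)
open import Data.Rational using (ℚ; ½; 0ℚ; _/_) renaming (_<_ to _<ℚ_; _+_ to _+ℚ_; _*_ to _*ℚ_)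
open import Data.Product using (_×_; ∃; ∃-syntax)
open import Relation.Nullary using (¬_)

open import Algebra.Bundles using (CommutativeRing)
open import Algebra.Solver.Ring.AlmostCommutativeRing
  using (AlmostCommutativeRing; fromCommutativeRing; _-Raw-AlmostCommutative⟶_)
import Algebra.Solver.Ring
open import Data.Integer as ℤ using (ℤ; -[1+_])
import Data.Integer.Properties as ℤ
open import Data.List using ([]; _∷_)
open import Data.Maybe using (Maybe; just; nothing)
open import Data.Nat using (zero; suc; _^_; s≤s; z≤n)
import Data.Nat as ℕ
import Data.Nat.Properties as ℕ
open import Data.Nat.Solver using () renaming (module +-*-Solver to ℕ-Solver)
open import Data.Product using (_,_; proj₁)
open import Data.Rational using (mkℚ; *<*; toℚᵘ)
import Data.Rational.Properties as ℚ
open import Data.Rational.Unnormalised as ℚᵘ using (mkℚᵘ)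
import Data.Rational.Unnormalised.Properties as ℚᵘ
open import Data.Sum using (inj₁; inj₂)
open import Relation.Binary.Bundles using (Setoid)
open import Relation.Binary.PropositionalEquality
  using (_≡_; _≢_; refl; sym; trans; cong; cong₂; subst; module ≡-Reasoning)
import Relation.Binary.Reasoning.Setoid as SetoidReasoning
open import Relation.Nullary using (yes; no)
open import Level using (0ℓ)

-- Polynomials up to equality of coefficients.

infix 4 _≈_

-- Lists that differ only in trailing zeros must count as equal. As a record, unlike a bare family
-- of equations, the relation lets unification recover `p` and `q`.
record _≈_ (p q : Poly) : Set where
  field coeff-≡ : ∀ k → coeff p k ≡ coeff q k

open _≈_

≈-refl : ∀ {p} → p ≈ p
≈-refl .coeff-≡ k = refl

≈-sym : ∀ {p q} → p ≈ q → q ≈ p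
≈-sym p≈q .coeff-≡ k = sym (p≈q .coeff-≡ k)

≈-trans : ∀ {p q r} → p ≈ q → q ≈ r → p ≈ r
≈-trans p≈q q≈r .coeff-≡ k = trans (p≈q .coeff-≡ k) (q≈r .coeff-≡ k)

≈-setoid : Setoid 0ℓ 0ℓ
≈-setoid = record
  { Carrier = Poly
  ; _≈_ = _≈_
  ; isEquivalence = record { refl = ≈-refl ; sym = ≈-sym ; trans = ≈-trans }
  }

module ≈-Reasoning = SetoidReasoning ≈-setoid

∷-cong : ∀ {a b p q} → a ≡ b → p ≈ q → a ∷ p ≈ b ∷ q
∷-cong a≡b p≈q .coeff-≡ zero    = a≡b
∷-cong a≡b p≈q .coeff-≡ (suc k) = p≈q .coeff-≡ k

0∷[]≈[] : + 0 ∷ [] ≈ []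
0∷[]≈[] .coeff-≡ zero    = refl
0∷[]≈[] .coeff-≡ (suc k) = refl

-- Addition, negation and scalar multiples.

-- Reduces each additive law to the same law of ℤ at a fixed index, with no further case split on
-- list lengths.
coeff-⊕ : ∀ p q k → coeff (p ⊕ q) k ≡ coeff p k ℤ.+ coeff q k
coeff-⊕ []      q       k       = sym (ℤ.+-identityˡ _)
coeff-⊕ (a ∷ p) []      k       = sym (ℤ.+-identityʳ _)
coeff-⊕ (a ∷ p) (b ∷ q) zero    = refl
coeff-⊕ (a ∷ p) (b ∷ q) (suc k) = coeff-⊕ p q k

coeff-scale : ∀ a p k → coeff (scale a p) k ≡ a ℤ.* coeff p k
coeff-scale a []      k       = sym (ℤ.*-zeroʳ a)
coeff-scale a (b ∷ p) zero    = refl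
coeff-scale a (b ∷ p) (suc k) = coeff-scale a p k

coeff-⊖ : ∀ p k → coeff (⊖ p) k ≡ ℤ.- coeff p k
coeff-⊖ []      k       = refl
coeff-⊖ (a ∷ p) zero    = refl
coeff-⊖ (a ∷ p) (suc k) = coeff-⊖ p k

⊕-cong : ∀ {p p′ q q′} → p ≈ p′ → q ≈ q′ → p ⊕ q ≈ p′ ⊕ q′
⊕-cong {p} {p′} {q} {q′} p≈p′ q≈q′ .coeff-≡ k = begin
  coeff (p ⊕ q) k            ≡⟨ coeff-⊕ p q k ⟩
  coeff p k ℤ.+ coeff q k    ≡⟨ cong₂ ℤ._+_ (p≈p′ .coeff-≡ k) (q≈q′ .coeff-≡ k) ⟩
  coeff p′ k ℤ.+ coeff q′ k  ≡⟨ coeff-⊕ p′ q′ k ⟨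
  coeff (p′ ⊕ q′) k          ∎
  where open ≡-Reasoning

⊕-comm : ∀ p q → p ⊕ q ≈ q ⊕ p
⊕-comm p q .coeff-≡ k = begin
  coeff (p ⊕ q) k          ≡⟨ coeff-⊕ p q k ⟩
  coeff p k ℤ.+ coeff q k  ≡⟨ ℤ.+-comm (coeff p k) (coeff q k) ⟩
  coeff q k ℤ.+ coeff p k  ≡⟨ coeff-⊕ q p k ⟨
  coeff (q ⊕ p) k          ∎
  where open ≡-Reasoning

⊕-assoc : ∀ p q r → (p ⊕ q) ⊕ r ≈ p ⊕ (q ⊕ r)
⊕-assoc p q r .coeff-≡ k = begin
  coeff ((p ⊕ q) ⊕ r) k                      ≡⟨ coeff-⊕ (p ⊕ q) r k ⟩
  coeff (p ⊕ q) k ℤ.+ coeff r k              ≡⟨ cong (ℤ._+ coeff r k) (coeff-⊕ p q k) ⟩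
  (coeff p k ℤ.+ coeff q k) ℤ.+ coeff r k    ≡⟨ ℤ.+-assoc (coeff p k) (coeff q k) (coeff r k) ⟩
  coeff p k ℤ.+ (coeff q k ℤ.+ coeff r k)    ≡⟨ cong (λ c → coeff p k ℤ.+ c) (coeff-⊕ q r k) ⟨
  coeff p k ℤ.+ coeff (q ⊕ r) k              ≡⟨ coeff-⊕ p (q ⊕ r) k ⟨
  coeff (p ⊕ (q ⊕ r)) k                      ∎
  where open ≡-Reasoning

⊕-identityʳ : ∀ p → p ⊕ [] ≈ p
⊕-identityʳ p = ⊕-comm p []

⊖-cong : ∀ {p q} → p ≈ q → ⊖ p ≈ ⊖ q
⊖-cong {p} {q} p≈q .coeff-≡ k =
  trans (coeff-⊖ p k) (trans (cong ℤ.-_ (p≈q .coeff-≡ k)) (sym (coeff-⊖ q k)))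

⊖-inverseʳ : ∀ p → p ⊕ (⊖ p) ≈ []
⊖-inverseʳ p .coeff-≡ k = begin
  coeff (p ⊕ (⊖ p)) k            ≡⟨ coeff-⊕ p (⊖ p) k ⟩
  coeff p k ℤ.+ coeff (⊖ p) k    ≡⟨ cong (λ c → coeff p k ℤ.+ c) (coeff-⊖ p k) ⟩
  coeff p k ℤ.+ ℤ.- coeff p k    ≡⟨ ℤ.+-inverseʳ (coeff p k) ⟩
  + 0                            ∎
  where open ≡-Reasoning

⊖-inverseˡ : ∀ p → (⊖ p) ⊕ p ≈ []
⊖-inverseˡ p = ≈-trans (⊕-comm (⊖ p) p) (⊖-inverseʳ p)

⊕-interchange : ∀ p q r s → (p ⊕ q) ⊕ (r ⊕ s) ≈ (p ⊕ r) ⊕ (q ⊕ s)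
⊕-interchange p q r s = begin
  (p ⊕ q) ⊕ (r ⊕ s)  ≈⟨ ⊕-assoc p q (r ⊕ s) ⟩
  p ⊕ (q ⊕ (r ⊕ s))  ≈⟨ ⊕-cong {p} ≈-refl swap ⟩
  p ⊕ (r ⊕ (q ⊕ s))  ≈⟨ ⊕-assoc p r (q ⊕ s) ⟨
  (p ⊕ r) ⊕ (q ⊕ s)  ∎
  where
  open ≈-Reasoning
  swap : q ⊕ (r ⊕ s) ≈ r ⊕ (q ⊕ s)
  swap = begin
    q ⊕ (r ⊕ s)  ≈⟨ ⊕-assoc q r s ⟨
    (q ⊕ r) ⊕ s  ≈⟨ ⊕-cong (⊕-comm q r) ≈-refl ⟩
    (r ⊕ q) ⊕ s  ≈⟨ ⊕-assoc r q s ⟩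
    r ⊕ (q ⊕ s)  ∎

scale-cong : ∀ a {p q} → p ≈ q → scale a p ≈ scale a q
scale-cong a {p} {q} p≈q .coeff-≡ k =
  trans (coeff-scale a p k) (trans (cong (a ℤ.*_) (p≈q .coeff-≡ k)) (sym (coeff-scale a q k)))

scale-distribˡ-⊕ : ∀ a p q → scale a (p ⊕ q) ≈ scale a p ⊕ scale a q
scale-distribˡ-⊕ a p q .coeff-≡ k = begin
  coeff (scale a (p ⊕ q)) k                      ≡⟨ coeff-scale a (p ⊕ q) k ⟩
  a ℤ.* coeff (p ⊕ q) k                          ≡⟨ cong (a ℤ.*_) (coeff-⊕ p q k) ⟩
  a ℤ.* (coeff p k ℤ.+ coeff q k)                ≡⟨ ℤ.*-distribˡ-+ a (coeff p k) (coeff q k) ⟩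
  a ℤ.* coeff p k ℤ.+ a ℤ.* coeff q k            ≡⟨ cong₂ ℤ._+_ (coeff-scale a p k) (coeff-scale a q k) ⟨
  coeff (scale a p) k ℤ.+ coeff (scale a q) k    ≡⟨ coeff-⊕ (scale a p) (scale a q) k ⟨
  coeff (scale a p ⊕ scale a q) k                ∎
  where open ≡-Reasoning

scale-scale : ∀ a b p → scale a (scale b p) ≈ scale (a ℤ.* b) p
scale-scale a b p .coeff-≡ k = begin
  coeff (scale a (scale b p)) k  ≡⟨ coeff-scale a (scale b p) k ⟩
  a ℤ.* coeff (scale b p) k      ≡⟨ cong (a ℤ.*_) (coeff-scale b p k) ⟩
  a ℤ.* (b ℤ.* coeff p k)        ≡⟨ ℤ.*-assoc a b (coeff p k) ⟨
  a ℤ.* b ℤ.* coeff p k          ≡⟨ coeff-scale (a ℤ.* b) p k ⟨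
  coeff (scale (a ℤ.* b) p) k    ∎
  where open ≡-Reasoning

scale-0 : ∀ p → scale (+ 0) p ≈ []
scale-0 p .coeff-≡ k = coeff-scale (+ 0) p k

scale-1 : ∀ p → scale (+ 1) p ≈ p
scale-1 p .coeff-≡ k = trans (coeff-scale (+ 1) p k) (ℤ.*-identityˡ _)

-- Multiplication of polynomials.

⊗-congˡ : ∀ p {q q′} → q ≈ q′ → p ⊗ q ≈ p ⊗ q′
⊗-congˡ []      q≈q′ = ≈-refl
⊗-congˡ (a ∷ p) q≈q′ = ⊕-cong (scale-cong a q≈q′) (∷-cong refl (⊗-congˡ p q≈q′))

⊗-zeroʳ : ∀ p → p ⊗ [] ≈ []
⊗-zeroʳ []      = ≈-refl
⊗-zeroʳ (a ∷ p) = ≈-trans (∷-cong refl (⊗-zeroʳ p)) 0∷[]≈[]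

-- The defining recursion of `⊗` mirrored to the second factor, which is what the induction for
-- commutativity needs.
⊗-∷ʳ : ∀ p b q → p ⊗ (b ∷ q) ≈ scale b p ⊕ (+ 0 ∷ (p ⊗ q))
⊗-∷ʳ []      b q = ≈-sym 0∷[]≈[]
⊗-∷ʳ (a ∷ p) b q = ∷-cong (cong (ℤ._+ + 0) (ℤ.*-comm a b)) (begin
  scale a q ⊕ (p ⊗ (b ∷ q))                    ≈⟨ ⊕-cong ≈-refl (⊗-∷ʳ p b q) ⟩
  scale a q ⊕ (scale b p ⊕ (+ 0 ∷ (p ⊗ q)))    ≈⟨ ⊕-assoc (scale a q) (scale b p) _ ⟨
  (scale a q ⊕ scale b p) ⊕ (+ 0 ∷ (p ⊗ q))    ≈⟨ ⊕-cong (⊕-comm (scale a q) (scale b p)) ≈-refl ⟩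
  (scale b p ⊕ scale a q) ⊕ (+ 0 ∷ (p ⊗ q))    ≈⟨ ⊕-assoc (scale b p) (scale a q) _ ⟩
  scale b p ⊕ (scale a q ⊕ (+ 0 ∷ (p ⊗ q)))    ∎)
  where open ≈-Reasoning

⊗-comm : ∀ p q → p ⊗ q ≈ q ⊗ p
⊗-comm []      q = ≈-sym (⊗-zeroʳ q)
⊗-comm (a ∷ p) q = ≈-trans (⊕-cong ≈-refl (∷-cong refl (⊗-comm p q))) (≈-sym (⊗-∷ʳ q a p))

-- Equal first factors may be lists of different lengths, which obstructs induction on them;
-- commutativity moves them to the second place.
⊗-cong : ∀ {p p′ q q′} → p ≈ p′ → q ≈ q′ → p ⊗ q ≈ p′ ⊗ q′
⊗-cong {p} {p′} {q} {q′} p≈p′ q≈q′ = begin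
  p ⊗ q    ≈⟨ ⊗-congˡ p q≈q′ ⟩
  p ⊗ q′   ≈⟨ ⊗-comm p q′ ⟩
  q′ ⊗ p   ≈⟨ ⊗-congˡ q′ p≈p′ ⟩
  q′ ⊗ p′  ≈⟨ ⊗-comm q′ p′ ⟩
  p′ ⊗ q′  ∎
  where open ≈-Reasoning

⊗-distribˡ-⊕ : ∀ p q r → p ⊗ (q ⊕ r) ≈ (p ⊗ q) ⊕ (p ⊗ r)
⊗-distribˡ-⊕ []      q r = ≈-refl
⊗-distribˡ-⊕ (a ∷ p) q r = begin
  scale a (q ⊕ r) ⊕ (+ 0 ∷ (p ⊗ (q ⊕ r)))
    ≈⟨ ⊕-cong (scale-distribˡ-⊕ a q r) (∷-cong refl (⊗-distribˡ-⊕ p q r)) ⟩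
  (scale a q ⊕ scale a r) ⊕ ((+ 0 ∷ (p ⊗ q)) ⊕ (+ 0 ∷ (p ⊗ r)))
    ≈⟨ ⊕-interchange (scale a q) (scale a r) _ _ ⟩
  (scale a q ⊕ (+ 0 ∷ (p ⊗ q))) ⊕ (scale a r ⊕ (+ 0 ∷ (p ⊗ r)))
    ∎
  where open ≈-Reasoning

⊗-distribʳ-⊕ : ∀ p q r → (q ⊕ r) ⊗ p ≈ (q ⊗ p) ⊕ (r ⊗ p)
⊗-distribʳ-⊕ p q r = begin
  (q ⊕ r) ⊗ p        ≈⟨ ⊗-comm (q ⊕ r) p ⟩
  p ⊗ (q ⊕ r)        ≈⟨ ⊗-distribˡ-⊕ p q r ⟩
  (p ⊗ q) ⊕ (p ⊗ r)  ≈⟨ ⊕-cong (⊗-comm p q) (⊗-comm p r) ⟩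
  (q ⊗ p) ⊕ (r ⊗ p)  ∎
  where open ≈-Reasoning

scale-⊗ : ∀ a p q → scale a p ⊗ q ≈ scale a (p ⊗ q)
scale-⊗ a []      q = ≈-refl
scale-⊗ a (b ∷ p) q = begin
  scale (a ℤ.* b) q ⊕ (+ 0 ∷ (scale a p ⊗ q))
    ≈⟨ ⊕-cong (≈-sym (scale-scale a b q)) (∷-cong (sym (ℤ.*-zeroʳ a)) (scale-⊗ a p q)) ⟩
  scale a (scale b q) ⊕ scale a (+ 0 ∷ (p ⊗ q))
    ≈⟨ scale-distribˡ-⊕ a (scale b q) (+ 0 ∷ (p ⊗ q)) ⟨
  scale a (scale b q ⊕ (+ 0 ∷ (p ⊗ q)))
    ∎
  where open ≈-Reasoning

⊗-assoc : ∀ p q r → (p ⊗ q) ⊗ r ≈ p ⊗ (q ⊗ r)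
⊗-assoc []      q r = ≈-refl
⊗-assoc (a ∷ p) q r = begin
  (scale a q ⊕ (+ 0 ∷ (p ⊗ q))) ⊗ r
    ≈⟨ ⊗-distribʳ-⊕ r (scale a q) (+ 0 ∷ (p ⊗ q)) ⟩
  -- The head of the shifted list contributes `scale (+ 0) r`, which vanishes.
  (scale a q ⊗ r) ⊕ (scale (+ 0) r ⊕ (+ 0 ∷ ((p ⊗ q) ⊗ r)))
    ≈⟨ ⊕-cong (scale-⊗ a q r) (⊕-cong (scale-0 r) (∷-cong refl (⊗-assoc p q r))) ⟩
  scale a (q ⊗ r) ⊕ (+ 0 ∷ (p ⊗ (q ⊗ r)))
    ∎
  where open ≈-Reasoning

-- The ring ℤ[t] and its solver.

const : ℤ → Poly
const a = a ∷ []

⊗-identityˡ : ∀ p → const (+ 1) ⊗ p ≈ p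
⊗-identityˡ p = ≈-trans (⊕-cong (scale-1 p) 0∷[]≈[]) (⊕-identityʳ p)

polyRing : CommutativeRing 0ℓ 0ℓ
polyRing = record
  { Carrier = Poly ; _≈_ = _≈_ ; _+_ = _⊕_ ; _*_ = _⊗_ ; -_ = ⊖_ ; 0# = [] ; 1# = const (+ 1)
  ; isCommutativeRing = record
    { isRing = record
      { +-isAbelianGroup = record
        { isGroup = record
          { isMonoid = record
            { isSemigroup = record
              { isMagma = record
                { isEquivalence = Setoid.isEquivalence ≈-setoid
                ; ∙-cong = ⊕-cong
                }
              ; assoc = ⊕-assoc
              }
            ; identity = (λ p → ≈-refl) , ⊕-identityʳ
            }
          ; inverse = ⊖-inverseˡ , ⊖-inverseʳ
          ; ⁻¹-cong = ⊖-cong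
          }
        ; comm = ⊕-comm
        }
      ; *-cong = ⊗-cong
      ; *-assoc = ⊗-assoc
      ; *-identity = ⊗-identityˡ , λ p → ≈-trans (⊗-comm p _) (⊗-identityˡ p)
      ; distrib = ⊗-distribˡ-⊕ , ⊗-distribʳ-⊕
      }
    ; *-comm = ⊗-comm
    }
  }

polyACR : AlmostCommutativeRing 0ℓ 0ℓ
polyACR = fromCommutativeRing polyRing

-- With ℤ as coefficient ring the solver can compute with numerals. Zero is preserved only up to
-- `≈`, because `const (+ 0)` is a list of length one.
const-homo : CommutativeRing.rawRing ℤ.+-*-commutativeRing -Raw-AlmostCommutative⟶ polyACR
const-homo = record
  { ⟦_⟧ = const
  ; +-homo = λ a b → ≈-refl
  ; *-homo = λ a b → ∷-cong (sym (ℤ.+-identityʳ (a ℤ.* b))) ≈-refl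
  ; -‿homo = λ a → ≈-refl
  ; 0-homo = 0∷[]≈[]
  ; 1-homo = ≈-refl
  }

const-≟ : ∀ a b → Maybe (const a ≈ const b)
const-≟ a b with a ℤ.≟ b
... | yes a≡b = just (∷-cong a≡b ≈-refl)
... | no  _   = nothing

module Solver = Algebra.Solver.Ring (CommutativeRing.rawRing ℤ.+-*-commutativeRing) polyACR const-homo const-≟

-- Leading coefficients and degrees.

-- Since `c` may be zero, this bounds the degree by `d` and records one coefficient. It is therefore
-- stable under sums and products; nonvanishing is asked for only in `lead⇒degree`.
record HasLead (p : Poly) (d : ℕ) (c : ℤ) : Set where
  constructor _,_
  field
    lead  : coeff p d ≡ c
    above : ∀ k → d < k → coeff p k ≡ + 0

lead⇒degree : ∀ {p d c} → HasLead p d c → c ≢ + 0 → HasDegree p d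
lead⇒degree (p≡c , above) c≢0 = (λ p≡0 → c≢0 (trans (sym p≡c) p≡0)) , above

lead-≈ : ∀ {p q d c} → p ≈ q → HasLead p d c → HasLead q d c
lead-≈ p≈q (p≡c , above) =
  trans (sym (p≈q .coeff-≡ _)) p≡c , λ k d<k → trans (sym (p≈q .coeff-≡ k)) (above k d<k)

lead-const : ∀ c → HasLead (const c) 0 c
lead-const c = refl , λ { (suc k) _ → refl }

lead-∷ : ∀ {a p d c} → HasLead p d c → HasLead (a ∷ p) (suc d) c
lead-∷ (p≡c , above) = p≡c , λ { (suc k) (s≤s d<k) → above k d<k }

lead-raise : ∀ {p d e c} → d < e → HasLead p d c → HasLead p e (+ 0)
lead-raise d<e (_ , above) = above _ d<e , λ k e<k → above k (ℕ.<-trans d<e e<k)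

lead-⊕ : ∀ p q {d a b} → HasLead p d a → HasLead q d b → HasLead (p ⊕ q) d (a ℤ.+ b)
lead-⊕ p q (p≡a , p-above) (q≡b , q-above) =
  trans (coeff-⊕ p q _) (cong₂ ℤ._+_ p≡a q≡b) ,
  λ k d<k → trans (coeff-⊕ p q k) (cong₂ ℤ._+_ (p-above k d<k) (q-above k d<k))

lead-⊕-lower : ∀ p q {d e a b} → e < d → HasLead p d a → HasLead q e b → HasLead (p ⊕ q) d a
lead-⊕-lower p q {d} e<d p-lead q-lead =
  subst (HasLead (p ⊕ q) d) (ℤ.+-identityʳ _) (lead-⊕ p q p-lead (lead-raise e<d q-lead))

lead-scale : ∀ a p {d c} → HasLead p d c → HasLead (scale a p) d (a ℤ.* c)
lead-scale a p (p≡c , above) =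
  trans (coeff-scale a p _) (cong (a ℤ.*_) p≡c) ,
  λ k d<k → trans (coeff-scale a p k) (trans (cong (a ℤ.*_) (above k d<k)) (ℤ.*-zeroʳ a))

lead-⊗ : ∀ p q {d e a b} → HasLead p d a → HasLead q e b → HasLead (p ⊗ q) (d + e) (a ℤ.* b)
lead-⊗ []      q (refl , _) _ = refl , λ _ _ → refl
-- Here the tail `p` has only zero coefficients, so the product is `scale c q`.
lead-⊗ (c ∷ p) q {zero} (refl , above) q-lead = lead-≈ scale≈⊗ (lead-scale c q q-lead)
  where
  open ≈-Reasoning
  []≈p : [] ≈ p
  []≈p .coeff-≡ k = sym (above (suc k) (s≤s z≤n))
  scale≈⊗ : scale c q ≈ (c ∷ p) ⊗ q
  scale≈⊗ = begin
    scale c q                    ≈⟨ ⊕-identityʳ (scale c q) ⟨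
    scale c q ⊕ []               ≈⟨ ⊕-cong {scale c q} ≈-refl 0∷[]≈[] ⟨
    scale c q ⊕ (+ 0 ∷ [])       ≈⟨ ⊕-cong {scale c q} ≈-refl (∷-cong refl (⊗-cong {q = q} []≈p ≈-refl)) ⟩
    scale c q ⊕ (+ 0 ∷ (p ⊗ q))  ∎
-- The summand `scale c q` has degree at most `e`, below `suc d + e`, so the shifted product alone
-- determines the coefficient.
lead-⊗ (c ∷ p) q {suc d} {e} (p≡a , above) q-lead =
  subst (HasLead ((c ∷ p) ⊗ q) (suc d + e)) (ℤ.+-identityˡ _)
    (lead-⊕ (scale c q) (+ 0 ∷ (p ⊗ q))
      (lead-raise (s≤s (ℕ.m≤n+m e d)) (lead-scale c q q-lead))
      (lead-∷ (lead-⊗ p q (p≡a , λ k d<k → above (suc k) (s≤s d<k)) q-lead)))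

-- The Pell equation over ℤ[t].

-- The square of t + √(t² + 1) is (2t² + 1) + 2t √(t² + 1), the multiplier that leads from one odd
-- power to the next.
X t²+1 2t²+1 : Poly
X = + 0 ∷ + 1 ∷ []
t²+1 = (X ⊗ X) ⊕ const (+ 1)
2t²+1 = (const (+ 2) ⊗ (X ⊗ X)) ⊕ const (+ 1)

-- u m + v m √(t² + 1) = (t + √(t² + 1)) ^ (2 m + 1).
u v : ℕ → Poly
u zero    = X
u (suc m) = (2t²+1 ⊗ u m) ⊕ ((const (+ 2) ⊗ X) ⊗ (t²+1 ⊗ v m))
v zero    = const (+ 1)
v (suc m) = ((const (+ 2) ⊗ X) ⊗ u m) ⊕ (2t²+1 ⊗ v m)

-- The norm is multiplicative and the multiplier has norm (2t² + 1)² - (2t)² (t² + 1) = 1, so each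
-- step preserves the left-hand side.
pell : ∀ m → (t²+1 ⊗ square (v m)) ⊝ square (u m) ≈ const (+ 1)
-- The left-hand list carries trailing zeros, hence the check index by index.
pell zero    .coeff-≡ 0 = refl
pell zero    .coeff-≡ 1 = refl
pell zero    .coeff-≡ 2 = refl
pell zero    .coeff-≡ 3 = refl
pell zero    .coeff-≡ (suc (suc (suc (suc k)))) = refl
pell (suc m) = ≈-trans
  (solve 3 (λ t p q →
      let d = t :* t :+ con (+ 1)
          e = con (+ 2) :* (t :* t) :+ con (+ 1)
          p′ = e :* p :+ (con (+ 2) :* t) :* (d :* q)
          q′ = (con (+ 2) :* t) :* p :+ e :* q
      in d :* (q′ :* q′) :+ :- (p′ :* p′) := d :* (q :* q) :+ :- (p :* p))
    ≈-refl X (u m) (v m))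
  (pell m)
  where open Solver

lead-t²+1 : HasLead t²+1 2 (+ 1)
lead-t²+1 = lead-∷ (lead-∷ (lead-const (+ 1)))

lead-2t²+1 : HasLead 2t²+1 2 (+ 2)
lead-2t²+1 = lead-∷ (lead-∷ (lead-const (+ 2)))

lead-2X : HasLead (const (+ 2) ⊗ X) 1 (+ 2)
lead-2X = lead-∷ (lead-const (+ 2))

2n+2n≡4n : ∀ n → + 2 ℤ.* + n ℤ.+ + 2 ℤ.* + n ≡ + (4 * n)
2n+2n≡4n n = trans (sym (ℤ.*-distribʳ-+ (+ n) (+ 2) (+ 2))) (sym (ℤ.pos-* 4 n))

-- In each recursion both summands have the same degree and leading coefficient 2 · 4^m, so they add
-- up to 4^(m+1) without cancelling. Writing `m * 2` makes `suc m * 2` reduce to two successors, and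
-- the degrees match by computation.
lead-u : ∀ m → HasLead (u m) (suc (m * 2)) (+ (4 ^ m))
lead-v : ∀ m → HasLead (v m) (m * 2) (+ (4 ^ m))

lead-u zero    = lead-∷ (lead-const (+ 1))
lead-u (suc m) = subst (HasLead (u (suc m)) _)
  (trans (cong (λ c → + 2 ℤ.* + (4 ^ m) ℤ.+ + 2 ℤ.* c) (ℤ.*-identityˡ (+ (4 ^ m)))) (2n+2n≡4n (4 ^ m)))
  (lead-⊕ (2t²+1 ⊗ u m) ((const (+ 2) ⊗ X) ⊗ (t²+1 ⊗ v m))
    (lead-⊗ 2t²+1 (u m) lead-2t²+1 (lead-u m))
    (lead-⊗ (const (+ 2) ⊗ X) (t²+1 ⊗ v m) lead-2X (lead-⊗ t²+1 (v m) lead-t²+1 (lead-v m))))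

lead-v zero    = lead-const (+ 1)
lead-v (suc m) = subst (HasLead (v (suc m)) _) (2n+2n≡4n (4 ^ m))
  (lead-⊕ ((const (+ 2) ⊗ X) ⊗ u m) (2t²+1 ⊗ v m)
    (lead-⊗ (const (+ 2) ⊗ X) (u m) lead-2X (lead-u m))
    (lead-⊗ 2t²+1 (v m) lead-2t²+1 (lead-v m)))

-- Danilov's identity.

quadratic : ℤ → ℤ → Poly → Poly
quadratic a b p = (p ⊗ p) ⊕ ((const a ⊗ p) ⊕ const b)

lead-quadratic : ∀ a b p {n c} → HasLead p (suc n) c →
  HasLead (quadratic a b p) (suc n + suc n) (c ℤ.* c)
lead-quadratic a b p {n} p-lead =
  lead-⊕-lower (p ⊗ p) ((const a ⊗ p) ⊕ const b) (ℕ.m<m+n (suc n) (s≤s z≤n))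
    (lead-⊗ p p p-lead p-lead)
    (lead-⊕-lower (const a ⊗ p) (const b) (s≤s z≤n)
      (lead-⊗ (const a) p (lead-const a) p-lead) (lead-const b))

-- The coefficients -[1+ 5 ], -[1+ 8 ], -[1+ 296 ] are -6, -9 and -297 = 27 * (-11).
hall-x hall-y : Poly → Poly → Poly → Poly
hall-x d p q = d ⊗ quadratic -[1+ 5 ] (+ 4) p
hall-y d p q = ((d ⊗ d) ⊗ q) ⊗ quadratic -[1+ 8 ] (+ 19) p

hall-residue : Poly → Poly → Poly
hall-residue d p = cube d ⊗ ((const (+ 54) ⊗ p) ⊕ const -[1+ 296 ])

-- With r = p² - 6p + 4 and s = p² - 9p + 19 one has r³ - (p² + 1) s² = 54p - 297. Replacing p² + 1
-- by d q² costs a multiple of 1 - (d q² - p²) with cofactor `w` = d³ s², which the hypothesis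
-- kills.
hall-identity : ∀ d p q → (d ⊗ square q) ⊝ square p ≈ const (+ 1) →
  cube (hall-x d p q) ⊝ square (hall-y d p q) ≈ hall-residue d p
hall-identity d p q dq²-p²≈1 = begin
  cube (hall-x d p q) ⊝ square (hall-y d p q)
    ≈⟨ expand ⟩
  hall-residue d p ⊕ (w ⊗ (const (+ 1) ⊝ ((d ⊗ square q) ⊝ square p)))
    ≈⟨ ⊕-cong {hall-residue d p} ≈-refl (⊗-congˡ w (⊕-cong {const (+ 1)} ≈-refl (⊖-cong dq²-p²≈1))) ⟩
  hall-residue d p ⊕ (w ⊗ (const (+ 1) ⊝ const (+ 1)))
    ≈⟨ ⊕-cong {hall-residue d p} ≈-refl (≈-trans (⊗-congˡ w 0∷[]≈[]) (⊗-zeroʳ w)) ⟩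
  hall-residue d p ⊕ []
    ≈⟨ ⊕-identityʳ _ ⟩
  hall-residue d p
    ∎
  where
  open ≈-Reasoning
  w : Poly
  w = cube d ⊗ square (quadratic -[1+ 8 ] (+ 19) p)
  expand : cube (hall-x d p q) ⊝ square (hall-y d p q)
    ≈ hall-residue d p ⊕ (w ⊗ (const (+ 1) ⊝ ((d ⊗ square q) ⊝ square p)))
  expand = solve 3 (λ d p q →
    let r = p :* p :+ (con -[1+ 5 ] :* p :+ con (+ 4))
        s = p :* p :+ (con -[1+ 8 ] :* p :+ con (+ 19))
        x = d :* r
        y = ((d :* d) :* q) :* s
        d³ = d :* (d :* d)
    in x :* (x :* x) :+ :- (y :* y)
       := d³ :* (con (+ 54) :* p :+ con -[1+ 296 ])
          :+ (d³ :* (s :* s)) :* (con (+ 1) :+ :- (d :* (q :* q) :+ :- (p :* p))))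
    ≈-refl d p q
    where open Solver

-- Degrees of x, y and x³ - y².

*-≢0 : ∀ {a b} → a ≢ + 0 → b ≢ + 0 → a ℤ.* b ≢ + 0
*-≢0 {a} a≢0 b≢0 ab≡0 with ℤ.i*j≡0⇒i≡0∨j≡0 a ab≡0
... | inj₁ a≡0 = a≢0 a≡0
... | inj₂ b≡0 = b≢0 b≡0

4^m≢0 : ∀ m → + (4 ^ m) ≢ + 0
4^m≢0 m 4^m≡0 = ℕ.≢-nonZero⁻¹ (4 ^ m) {{ℕ.m^n≢0 4 m}} (ℤ.+-injective 4^m≡0)

-- Here δ is `2 + n`. The degrees add up to 2 + 2(n + 1) = 2δ, 4 + n + 2(n + 1) = 3δ and 6 + (n + 1)
-- = δ + 5.
module _ (d p q : Poly) {n c} (c≢0 : c ≢ + 0)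
  (d-lead : HasLead d 2 (+ 1)) (p-lead : HasLead p (suc n) c) (q-lead : HasLead q n c)
  where

  open ℕ-Solver

  private
    c²≢0 : c ℤ.* c ≢ + 0
    c²≢0 = *-≢0 {c} {c} c≢0 c≢0

    d²-lead : HasLead (d ⊗ d) 4 (+ 1)
    d²-lead = lead-⊗ d d d-lead d-lead

  degree-hall-x : HasDegree (hall-x d p q) (2 * (2 + n))
  degree-hall-x = subst (HasDegree (hall-x d p q))
    (solve 1 (λ n → con 2 :+ ((con 1 :+ n) :+ (con 1 :+ n)) := con 2 :* (con 2 :+ n)) refl n)
    (lead⇒degree (lead-⊗ d (quadratic -[1+ 5 ] (+ 4) p) d-lead (lead-quadratic -[1+ 5 ] (+ 4) p p-lead))
      (*-≢0 {+ 1} {c ℤ.* c} (λ ()) c²≢0))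

  degree-hall-y : HasDegree (hall-y d p q) (3 * (2 + n))
  degree-hall-y = subst (HasDegree (hall-y d p q))
    (solve 1 (λ n → (con 4 :+ n) :+ ((con 1 :+ n) :+ (con 1 :+ n)) := con 3 :* (con 2 :+ n)) refl n)
    (lead⇒degree
      (lead-⊗ ((d ⊗ d) ⊗ q) (quadratic -[1+ 8 ] (+ 19) p)
        (lead-⊗ (d ⊗ d) q d²-lead q-lead) (lead-quadratic -[1+ 8 ] (+ 19) p p-lead))
      (*-≢0 {+ 1 ℤ.* c} {c ℤ.* c} (*-≢0 {+ 1} {c} (λ ()) c≢0) c²≢0))

  degree-hall-residue : HasDegree (hall-residue d p) (2 + n + 5)
  degree-hall-residue = subst (HasDegree (hall-residue d p))
    (solve 1 (λ n → con 6 :+ (con 1 :+ n) := (con 2 :+ n) :+ con 5) refl n)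
    (lead⇒degree
      (lead-⊗ (cube d) ((const (+ 54) ⊗ p) ⊕ const -[1+ 296 ]) (lead-⊗ d (d ⊗ d) d-lead d²-lead)
        (lead-⊕-lower (const (+ 54) ⊗ p) (const -[1+ 296 ]) (s≤s z≤n)
          (lead-⊗ (const (+ 54)) p (lead-const (+ 54)) p-lead) (lead-const -[1+ 296 ])))
      (*-≢0 {+ 1} {+ 54 ℤ.* c} (λ ()) (*-≢0 {+ 54} {c} (λ ()) c≢0)))

degree-≈ : ∀ {p q d} → p ≈ q → HasDegree p d → HasDegree q d
degree-≈ p≈q (p≢0 , above) =
  (λ q≡0 → p≢0 (trans (p≈q .coeff-≡ _) q≡0)) , λ k d<k → trans (sym (p≈q .coeff-≡ k)) (above k d<k)

x y : ℕ → Poly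
x m = hall-x t²+1 (u m) (v m)
y m = hall-y t²+1 (u m) (v m)

degree-x : ∀ m → HasDegree (x m) (2 * (suc m * 2))
degree-x m = degree-hall-x t²+1 (u m) (v m) (4^m≢0 m) lead-t²+1 (lead-u m) (lead-v m)

degree-y : ∀ m → HasDegree (y m) (3 * (suc m * 2))
degree-y m = degree-hall-y t²+1 (u m) (v m) (4^m≢0 m) lead-t²+1 (lead-u m) (lead-v m)

-- The top terms of x³ and y² cancel, so the degree is read off the residue instead.
degree-x³-y² : ∀ m → HasDegree (cube (x m) ⊝ square (y m)) (suc m * 2 + 5)
degree-x³-y² m = degree-≈ {hall-residue t²+1 (u m)} {cube (x m) ⊝ square (y m)}
  (≈-sym (hall-identity t²+1 (u m) (v m) (pell m)))
  (degree-hall-residue t²+1 (u m) (v m) (4^m≢0 m) lead-t²+1 (lead-u m) (lead-v m))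

-- The bound on the ratio of degrees.

-- For ε = n/d the choice δ = 6 d gives 2 ε δ = 12 n > 5.
ratio-bound : ∀ ε → 0ℚ <ℚ ε → ∃[ m ]
  (+ (suc m * 2 + 5) / 1) <ℚ ((½ +ℚ ε) *ℚ (+ (2 * (suc m * 2)) / 1))
ratio-bound (mkℚ (+ zero) _ _)    (*<* (ℤ.+<+ ()))
ratio-bound (mkℚ -[1+ _ ] _ _)    (*<* ())
-- The numerator is `suc n` and the denominator `suc e`. On unnormalised rationals the order is
-- plain cross multiplication, which leaves the inequality `gap` of natural numbers.
ratio-bound ε@(mkℚ (+ suc n) e _) _ = m , ℚ.toℚᵘ-cancel-<
  (ℚᵘ.<-respˡ-≃ (ℚᵘ.≃-sym (ℚ.toℚᵘ-fromℚᵘ (mkℚᵘ (+ (δ + 5)) 0)))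
    (ℚᵘ.<-respʳ-≃ (ℚᵘ.≃-sym rhs) (ℚᵘ.*<* (ℤ.+<+ gap))))
  where
  -- Chosen so that `suc m` is 3 · `suc e`, whence δ is six times the denominator.
  m = e + 2 * suc e
  δ = suc m * 2

  rhs : toℚᵘ ((½ +ℚ ε) *ℚ (+ (2 * δ) / 1)) ℚᵘ.≃ (toℚᵘ ½ ℚᵘ.+ toℚᵘ ε) ℚᵘ.* mkℚᵘ (+ (2 * δ)) 0
  rhs = ℚᵘ.≃-trans (ℚ.toℚᵘ-homo-* (½ +ℚ ε) (+ (2 * δ) / 1))
    (ℚᵘ.*-cong (ℚ.toℚᵘ-homo-+ ½ ε) (ℚ.toℚᵘ-fromℚᵘ (mkℚᵘ (+ (2 * δ)) 0)))

  -- With d = `suc e` the two sides of `gap` differ by 24(n + 1)d - 10d = 24nd + 14e + 14; one unit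
  -- is split off for strictness.
  expand : suc ((δ + 5) * (2 * suc e * 1) + (24 * (n * suc e) + 14 * e + 13))
    ≡ (1 * suc e + suc n * 2) * (2 * δ) * 1
  expand = solve 2 (λ n e →
    let d = con 1 :+ e
        δ = (con 1 :+ (e :+ con 2 :* d)) :* con 2
    in con 1 :+ ((δ :+ con 5) :* (con 2 :* d :* con 1) :+ (con 24 :* (n :* d) :+ con 14 :* e :+ con 13))
       := (con 1 :* d :+ (con 1 :+ n) :* con 2) :* (con 2 :* δ) :* con 1) refl n e
    where open ℕ-Solver

  gap : (δ + 5) * (2 * suc e * 1) < (1 * suc e + suc n * 2) * (2 * δ) * 1
  gap = subst ((δ + 5) * (2 * suc e * 1) <_) expand (s≤s (ℕ.m≤m+n _ (24 * (n * suc e) + 14 * e + 13)))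

theorem1 : ((ε : ℚ) → 0ℚ <ℚ ε →
    ∃[ x ] ∃[ y ] ∃[ dx ] ∃[ dr ]
    (¬ IsZeroPoly (cube x ⊝ square y)
    × HasDegree x dx × 0 < dx
    × HasDegree (cube x ⊝ square y) dr
    × ((+ dr / 1) <ℚ ((½ +ℚ ε) *ℚ (+ dx / 1)))))
    × ((δ : ℕ) → 2 ∣ δ → 0 < δ →
    ∃[ x ] ∃[ y ]
    (HasDegree x (2 * δ) × HasDegree y (3 * δ)
    × HasDegree (cube x ⊝ square y) (δ + 5)))
theorem1 = small-ratio , exact-degrees
  where
  small-ratio : (ε : ℚ) → 0ℚ <ℚ ε → _
  small-ratio ε 0<ε with m , bound ← ratio-bound ε 0<ε =
    -- A zero difference would contradict its nonzero coefficient at the degree.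
    x m , y m , _ , _ , (λ zero → degree-x³-y² m .proj₁ (zero _)) ,
    degree-x m , s≤s z≤n , degree-x³-y² m , bound

  exact-degrees : (δ : ℕ) → 2 ∣ δ → 0 < δ → _
  -- A zero quotient would make δ zero, contrary to positivity, so δ is `suc m * 2`.
  exact-degrees _ (divides (suc m) refl) _ =
    x m , y m , degree-x m , degree-y m , degree-x³-y² m
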